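{- For every even positive integer $n$ and every two points $x,y\in\mathcal{B}_n$, where $\mathcal{B}_n=\{x\in\{0,1\}^{n+1}: |x|>n/2\}$, there is a bijection $f\colon\mathcal{B}_n\to\mathcal{B}_n$ such that $f(x)=y$, $f(y)=x$, and for all $z\neq w$ in $\mathcal{B}_n$, \[ \frac1{20}\le\frac{\mathrm{distance}(f(z),f(w))}{\mathrm{distance}(z,w)}\le 20 . \]
   Context: For a binary string $x$, $|x|$ denotes its Hamming weight (number of ones), and $\mathrm{distance}(\cdot,\cdot)$ denotes the Hamming distance between binary strings of equal length. -}

module Defs where

open import Data.Bool.Base using (Bool; true; false)
open import Data.Bool.Properties using (_≟_)
open import Data.Nat.Base using (ℕ; suc; _<_; _/_; NonZero; ≢-nonZero)
open import Data.Nat.Properties using (<-irrelevant)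
open import Data.Product.Base using (Σ-syntax; _,_; proj₁; uncurry)
open import Data.Vec.Base using (Vec; []; _∷_; count; zip)
open import Relation.Binary.PropositionalEquality
  using (_≡_; _≢_; refl; cong)
open import Relation.Nullary.Decidable.Core using (¬?)

private
  variable
    m n : ℕ

weight : Vec Bool n → ℕ
weight = count (_≟ true)

distance : Vec Bool n → Vec Bool n → ℕ
distance x y = count (λ ab → ¬? (uncurry _≟_ ab)) (zip x y)

-- Rounding in n / 2 is harmless: it is exact for even n, and for odd n an
-- integer exceeds n/2 iff it exceeds ⌊n/2⌋.  Proofs of _<_ on ℕ are unique, so
-- propositional equality in 𝓑 n is equality of the underlying strings.
𝓑 : ℕ → Set
𝓑 n = Σ[ x ∈ Vec Bool (suc n) ] n / 2 < weight x

𝓑-distance : 𝓑 n → 𝓑 n → ℕ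
𝓑-distance z w = distance (proj₁ z) (proj₁ w)

distance≡0⇒≡ : (x y : Vec Bool m) → distance x y ≡ 0 → x ≡ y
distance≡0⇒≡ []          []          _  = refl
distance≡0⇒≡ (true  ∷ x) (true  ∷ y) eq = cong (true ∷_) (distance≡0⇒≡ x y eq)
distance≡0⇒≡ (false ∷ x) (false ∷ y) eq = cong (false ∷_) (distance≡0⇒≡ x y eq)
distance≡0⇒≡ (true  ∷ x) (false ∷ y) ()
distance≡0⇒≡ (false ∷ x) (true  ∷ y) ()

𝓑-≡ : {z w : 𝓑 n} → proj₁ z ≡ proj₁ w → z ≡ w
𝓑-≡ {z = x , p} {w = .x , q} refl = cong (x ,_) (<-irrelevant p q)

𝓑-distance-nonZero : {z w : 𝓑 n} → z ≢ w → NonZero (𝓑-distance z w)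
𝓑-distance-nonZero {z = z} {w} z≢w =
  ≢-nonZero λ eq → z≢w (𝓑-≡ (distance≡0⇒≡ (proj₁ z) (proj₁ w) eq))

{-# OPTIONS --safe #-}

-- Read 1 as an opening and 0 as a closing bracket.  The cube is mapped onto the
-- ball by turning the rightmost half of the unmatched zeros into ones, with one
-- extra bit recording the parity of their number (the symmetric chain
-- decomposition of de Bruijn, Tengbergen and Kruyswijk).  This map is
-- 4-Lipschitz and its inverse is 5-Lipschitz.  Conjugating a translation of the
-- cube by it gives an involution of the ball swapping x and y, and for an
-- involution the Lipschitz constant 4 · 5 also yields the lower bound.
module Submission where

open import Defs
open import Data.Bool.Base using (Bool; true; false; not; _xor_)
open import Data.Bool.Properties using (not-involutive; xor-assoc; xor-comm; xor-same; xor-identityʳ)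
open import Data.Nat.Base using (ℕ; zero; suc; pred; _+_; _*_; _∸_; _⊓_; _<_; z≤n; s≤s; s≤s⁻¹; ⌊_/2⌋; NonZero)
  renaming (_≤_ to _≤ℕ_; _/_ to _/ℕ_)
open import Data.Nat.Divisibility using (_∣_; divides)
open import Data.Nat.DivMod using (m*n/n≡m)
open import Data.Nat.Properties
open import Data.Nat.Solver using (module +-*-Solver)
open import Data.Product.Base using (Σ-syntax; _×_; _,_; proj₁)
open import Data.Rational.Base using (_/_; _≤_)
open import Data.Rational.Properties using (toℚᵘ-cancel-≤; toℚᵘ-fromℚᵘ)
open import Data.Rational.Unnormalised.Base using (mkℚᵘ; *≤*)
import Data.Rational.Unnormalised.Properties as ℚᵘₚ
open import Data.Sum.Base using (_⊎_; inj₁; inj₂)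
open import Data.Vec.Base using (Vec; []; _∷_; _∷ʳ_; map; reverse; zipWith)
open import Data.Vec.Properties using (reverse-∷; map-reverse; reverse-involutive; map-∘; map-id; map-cong; zipWith-comm)
open import Function.Base using (_∘_)
open import Function.Bundles using (_⤖_; module Bijection; mk↔ₛ′)
open import Function.Properties.Inverse using (↔⇒⤖)
open import Relation.Binary.PropositionalEquality
open import Relation.Nullary.Negation using (contradiction)

private
  variable
    m n : ℕ

-- Hamming distance

distance-refl : (x : Vec Bool n) → distance x x ≡ 0
distance-refl []          = refl
distance-refl (true  ∷ x) = distance-refl x
distance-refl (false ∷ x) = distance-refl x

distance-sym : (x y : Vec Bool n) → distance x y ≡ distance y x
distance-sym []          []          = refl
distance-sym (true  ∷ x) (true  ∷ y) = distance-sym x y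
distance-sym (true  ∷ x) (false ∷ y) = cong suc (distance-sym x y)
distance-sym (false ∷ x) (true  ∷ y) = cong suc (distance-sym x y)
distance-sym (false ∷ x) (false ∷ y) = distance-sym x y

distance-∷ : ∀ a b (x y : Vec Bool n) → distance (a ∷ x) (b ∷ y) ≡ distance (a ∷ []) (b ∷ []) + distance x y
distance-∷ true  true  x y = refl
distance-∷ true  false x y = refl
distance-∷ false true  x y = refl
distance-∷ false false x y = refl

distance-∷-same : ∀ a (x y : Vec Bool n) → distance (a ∷ x) (a ∷ y) ≡ distance x y
distance-∷-same true  x y = refl
distance-∷-same false x y = refl

distance-singleton : ∀ a b → distance (a ∷ []) (b ∷ []) ≤ℕ 1
distance-singleton true  true  = z≤n
distance-singleton true  false = ≤-refl
distance-singleton false true  = ≤-refl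
distance-singleton false false = z≤n

distance-triangle : (x y z : Vec Bool n) → distance x z ≤ℕ distance x y + distance y z
distance-triangle []          []          []          = z≤n
distance-triangle (true  ∷ x) (true  ∷ y) (true  ∷ z) = distance-triangle x y z
distance-triangle (false ∷ x) (false ∷ y) (false ∷ z) = distance-triangle x y z
distance-triangle (false ∷ x) (true  ∷ y) (true  ∷ z) = s≤s (distance-triangle x y z)
distance-triangle (true  ∷ x) (false ∷ y) (false ∷ z) = s≤s (distance-triangle x y z)
distance-triangle (true  ∷ x) (true  ∷ y) (false ∷ z) =
  ≤-trans (s≤s (distance-triangle x y z)) (≤-reflexive (sym (+-suc _ _)))
distance-triangle (false ∷ x) (false ∷ y) (true  ∷ z) =
  ≤-trans (s≤s (distance-triangle x y z)) (≤-reflexive (sym (+-suc _ _)))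
distance-triangle (true  ∷ x) (false ∷ y) (true  ∷ z) =
  ≤-trans (distance-triangle x y z) (+-mono-≤ (n≤1+n _) (n≤1+n _))
distance-triangle (false ∷ x) (true  ∷ y) (false ∷ z) =
  ≤-trans (distance-triangle x y z) (+-mono-≤ (n≤1+n _) (n≤1+n _))

distance-∷ʳ : ∀ a b (x y : Vec Bool n) → distance (x ∷ʳ a) (y ∷ʳ b) ≡ distance (a ∷ x) (b ∷ y)
distance-∷ʳ a b []      []      = refl
distance-∷ʳ a b (c ∷ x) (d ∷ y) = begin
  distance ((c ∷ x) ∷ʳ a) ((d ∷ y) ∷ʳ b) ≡⟨ distance-∷ c d (x ∷ʳ a) (y ∷ʳ b) ⟩
  cd + distance (x ∷ʳ a) (y ∷ʳ b)    ≡⟨ cong (cd +_) (distance-∷ʳ a b x y) ⟩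
  cd + distance (a ∷ x) (b ∷ y)      ≡⟨ cong (cd +_) (distance-∷ a b x y) ⟩
  cd + (ab + distance x y)           ≡⟨ +-assoc cd ab (distance x y) ⟨
  cd + ab + distance x y             ≡⟨ cong (_+ distance x y) (+-comm cd ab) ⟩
  ab + cd + distance x y             ≡⟨ +-assoc ab cd (distance x y) ⟩
  ab + (cd + distance x y)           ≡⟨ cong (ab +_) (distance-∷ c d x y) ⟨
  ab + distance (c ∷ x) (d ∷ y)      ≡⟨ distance-∷ a b (c ∷ x) (d ∷ y) ⟨
  distance (a ∷ c ∷ x) (b ∷ d ∷ y)   ∎
  where
  open ≡-Reasoning
  ab = distance (a ∷ []) (b ∷ [])
  cd = distance (c ∷ []) (d ∷ [])

_⊕_ : Vec Bool n → Vec Bool n → Vec Bool n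
_⊕_ = zipWith _xor_

⊕-comm : (x y : Vec Bool n) → x ⊕ y ≡ y ⊕ x
⊕-comm = zipWith-comm xor-comm

⊕-cancelʳ : (x y : Vec Bool n) → (x ⊕ y) ⊕ y ≡ x
⊕-cancelʳ []      []      = refl
⊕-cancelʳ (a ∷ x) (b ∷ y) = cong₂ _∷_ (begin
  (a xor b) xor b ≡⟨ xor-assoc a b b ⟩
  a xor (b xor b) ≡⟨ cong (a xor_) (xor-same b) ⟩
  a xor false     ≡⟨ xor-identityʳ a ⟩
  a               ∎) (⊕-cancelʳ x y)
  where open ≡-Reasoning

distance-⊕ : (x y z : Vec Bool n) → distance (x ⊕ z) (y ⊕ z) ≡ distance x y
distance-⊕ []          []          []          = refl
distance-⊕ (true  ∷ x) (true  ∷ y) (true  ∷ z) = distance-⊕ x y z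
distance-⊕ (true  ∷ x) (true  ∷ y) (false ∷ z) = distance-⊕ x y z
distance-⊕ (true  ∷ x) (false ∷ y) (true  ∷ z) = cong suc (distance-⊕ x y z)
distance-⊕ (true  ∷ x) (false ∷ y) (false ∷ z) = cong suc (distance-⊕ x y z)
distance-⊕ (false ∷ x) (true  ∷ y) (true  ∷ z) = cong suc (distance-⊕ x y z)
distance-⊕ (false ∷ x) (true  ∷ y) (false ∷ z) = cong suc (distance-⊕ x y z)
distance-⊕ (false ∷ x) (false ∷ y) (true  ∷ z) = distance-⊕ x y z
distance-⊕ (false ∷ x) (false ∷ y) (false ∷ z) = distance-⊕ x y z

-- Orienting an edge from the endpoint with the extra one makes the comparisons of `freeZeros` and
-- `depth` along it one-sided.
data Edge : Vec Bool n → Vec Bool n → Set where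
  here  : (x : Vec Bool n) → Edge (true ∷ x) (false ∷ x)
  there : ∀ a {x y : Vec Bool n} → Edge x y → Edge (a ∷ x) (a ∷ y)

-- Strings at distance d are joined by a path of d edges. The map `g` is general so that the
-- induction can restrict it to strings with a given first bit.
edge-lipschitz⇒lipschitz :
  ∀ K (g : Vec Bool n → Vec Bool m) →
  (∀ {x y} → Edge x y → distance (g x) (g y) ≤ℕ K) →
  ∀ x y → distance (g x) (g y) ≤ℕ K * distance x y
edge-lipschitz⇒lipschitz K g edge [] [] =
  ≤-trans (≤-reflexive (distance-refl (g []))) z≤n
edge-lipschitz⇒lipschitz K g edge (true  ∷ x) (true  ∷ y) =
  edge-lipschitz⇒lipschitz K (g ∘ (true ∷_)) (edge ∘ there true) x y
edge-lipschitz⇒lipschitz K g edge (false ∷ x) (false ∷ y) =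
  edge-lipschitz⇒lipschitz K (g ∘ (false ∷_)) (edge ∘ there false) x y
edge-lipschitz⇒lipschitz K g edge (true  ∷ x) (false ∷ y) = begin
  distance (g (true ∷ x)) (g (false ∷ y))
    ≤⟨ distance-triangle (g (true ∷ x)) (g (false ∷ x)) (g (false ∷ y)) ⟩
  distance (g (true ∷ x)) (g (false ∷ x)) + distance (g (false ∷ x)) (g (false ∷ y))
    ≤⟨ +-mono-≤ (edge (here x)) (edge-lipschitz⇒lipschitz K (g ∘ (false ∷_)) (edge ∘ there false) x y) ⟩
  K + K * distance x y
    ≡⟨ *-suc K (distance x y) ⟨
  K * suc (distance x y)
    ∎
  where open ≤-Reasoning
edge-lipschitz⇒lipschitz K g edge (false ∷ x) (true  ∷ y) = begin
  distance (g (false ∷ x)) (g (true ∷ y))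
    ≤⟨ distance-triangle (g (false ∷ x)) (g (true ∷ x)) (g (true ∷ y)) ⟩
  distance (g (false ∷ x)) (g (true ∷ x)) + distance (g (true ∷ x)) (g (true ∷ y))
    ≤⟨ +-mono-≤ (≤-trans (≤-reflexive (distance-sym (g (false ∷ x)) _)) (edge (here x)))
                (edge-lipschitz⇒lipschitz K (g ∘ (true ∷_)) (edge ∘ there true) x y) ⟩
  K + K * distance x y
    ≡⟨ *-suc K (distance x y) ⟨
  K * suc (distance x y)
    ∎
  where open ≤-Reasoning

edge-weight : {x y : Vec Bool n} → Edge x y → weight x ≡ suc (weight y)
edge-weight (here x)        = refl
edge-weight (there true  e) = cong suc (edge-weight e)
edge-weight (there false e) = edge-weight e

-- Bracket matching

-- Counts unmatched zeros: a leading one matches the first unmatched zero of the tail, and stays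
-- unmatched, by `pred 0 = 0`, if there is none.
freeZeros : Vec Bool n → ℕ
freeZeros []          = 0
freeZeros (true  ∷ x) = pred (freeZeros x)
freeZeros (false ∷ x) = suc (freeZeros x)

-- The number of unmatched ones of 1ᵗ x.
depth : ℕ → Vec Bool n → ℕ
depth t []          = t
depth t (true  ∷ x) = depth (suc t) x
depth t (false ∷ x) = depth (pred t) x

-- Turns into ones the zeros of x that are unmatched in 1ᵗ x.
fill : ℕ → Vec Bool n → Vec Bool n
fill t       []          = []
fill t       (true  ∷ x) = true  ∷ fill (suc t) x
fill zero    (false ∷ x) = true  ∷ fill 0 x
fill (suc t) (false ∷ x) = false ∷ fill t x

-- Both the brackets and the reading direction are exchanged, so matched pairs survive while
-- unmatched ones and unmatched zeros swap roles. Undoing a filling is thus again a filling.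
dual : Vec Bool n → Vec Bool n
dual x = reverse (map not x)

-- The prefixed ones are first absorbed by the unmatched zeros of `x`; only the surplus stays open.
depth-formula : ∀ t (x : Vec Bool n) → depth t x ≡ depth 0 x + (t ∸ freeZeros x)
depth-formula t []          = refl
depth-formula t (true  ∷ x) rewrite depth-formula (suc t) x | depth-formula 1 x with freeZeros x
... | zero  = sym (+-assoc (depth 0 x) 1 t)
... | suc k = cong (_+ (t ∸ k)) (sym (trans (cong (depth 0 x +_) (0∸n≡0 k)) (+-identityʳ _)))
depth-formula t (false ∷ x) rewrite depth-formula (pred t) x with t
... | zero  = cong (λ k → depth 0 x + k) (0∸n≡0 (freeZeros x))
... | suc _ = refl

-- With p matched pairs, the weight is p plus the unmatched ones, and `n` is 2p plus all unmatched
-- bits.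
weight-depth : (x : Vec Bool n) → freeZeros x + (weight x + weight x) ≡ depth 0 x + n
weight-depth []          = refl
weight-depth {suc n} (false ∷ x) = trans (cong suc (weight-depth x)) (sym (+-suc _ n))
weight-depth {suc n} (true  ∷ x) rewrite depth-formula 1 x with freeZeros x | weight-depth x
... | zero  | ih = begin
  suc (weight x) + suc (weight x)   ≡⟨ cong suc (+-suc (weight x) (weight x)) ⟩
  2 + (weight x + weight x)         ≡⟨ cong (2 +_) ih ⟩
  2 + (depth 0 x + n)               ≡⟨ solve 2 (λ d n → con 2 :+ (d :+ n) := d :+ con 1 :+ (con 1 :+ n)) refl (depth 0 x) n ⟩
  depth 0 x + 1 + suc n             ∎
  where
  open ≡-Reasoning
  open +-*-Solver
... | suc k | ih = begin
  k + (suc (weight x) + suc (weight x)) ≡⟨ solve 2 (λ k w → k :+ ((con 1 :+ w) :+ (con 1 :+ w)) := con 1 :+ ((con 1 :+ k) :+ (w :+ w))) refl k (weight x) ⟩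
  suc (suc k + (weight x + weight x))   ≡⟨ cong suc ih ⟩
  suc (depth 0 x + n)                   ≡⟨ solve 2 (λ d n → con 1 :+ (d :+ n) := d :+ con 0 :+ (con 1 :+ n)) refl (depth 0 x) n ⟩
  depth 0 x + 0 + suc n                 ≡⟨ cong (λ j → depth 0 x + j + suc n) (0∸n≡0 k) ⟨
  depth 0 x + (0 ∸ k) + suc n           ∎
  where
  open ≡-Reasoning
  open +-*-Solver

n≤1+pred[n] : ∀ k → k ≤ℕ suc (pred k)
n≤1+pred[n] zero    = z≤n
n≤1+pred[n] (suc k) = ≤-refl

freeZeros≤⇒fill≡ : ∀ t (x : Vec Bool n) → freeZeros x ≤ℕ t → fill t x ≡ x
freeZeros≤⇒fill≡ t       []          _       = refl
freeZeros≤⇒fill≡ t       (true  ∷ x) z≤t     = cong (true ∷_) (freeZeros≤⇒fill≡ (suc t) x (≤-trans (n≤1+pred[n] (freeZeros x)) (s≤s z≤t)))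
freeZeros≤⇒fill≡ (suc t) (false ∷ x) (s≤s p) = cong (false ∷_) (freeZeros≤⇒fill≡ t x p)

-- The prefix saves the leftmost unmatched zeros. The new ones lie to the right of these and cannot
-- match them.
freeZeros-fill : ∀ t (x : Vec Bool n) → freeZeros (fill t x) ≡ t ⊓ freeZeros x
freeZeros-fill t       []          = sym (⊓-zeroʳ t)
freeZeros-fill zero    (true  ∷ x) rewrite freeZeros-fill 1 x with freeZeros x
... | zero  = refl
... | suc _ = refl
freeZeros-fill (suc t) (true  ∷ x) rewrite freeZeros-fill (suc (suc t)) x with freeZeros x
... | zero  = refl
... | suc _ = refl
freeZeros-fill zero    (false ∷ x) rewrite freeZeros-fill 0 x = refl
freeZeros-fill (suc t) (false ∷ x) = cong suc (freeZeros-fill t x)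

-- A turned zero becomes an unmatched one: every zero to its right is either turned too or matched
-- with a one that is also to its right.
depth-fill : ∀ t (x : Vec Bool n) → depth 0 (fill t x) ≡ depth 0 x + (freeZeros x ∸ t)
depth-fill t       []          = sym (0∸n≡0 t)
depth-fill t       (true  ∷ x)
  rewrite depth-formula 1 (fill (suc t) x) | depth-formula 1 x | depth-fill (suc t) x | freeZeros-fill (suc t) x
  with freeZeros x
... | zero  = trans (+-assoc (depth 0 x) 0 1) (trans (sym (+-identityʳ _)) (cong (depth 0 x + 1 +_) (sym (0∸n≡0 t))))
... | suc k rewrite 0∸n≡0 k | 0∸n≡0 (t ⊓ k) | +-identityʳ (depth 0 x) = +-identityʳ _
depth-fill zero    (false ∷ x)
  rewrite depth-formula 1 (fill 0 x) | depth-fill 0 x | freeZeros-fill 0 x =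
  trans (+-assoc (depth 0 x) (freeZeros x) 1) (cong (depth 0 x +_) (+-comm (freeZeros x) 1))
depth-fill (suc t) (false ∷ x) = depth-fill t x

-- Duality and the inversion of filling

dual-∷ : ∀ a (x : Vec Bool n) → dual (a ∷ x) ≡ dual x ∷ʳ not a
dual-∷ a x = reverse-∷ (not a) (map not x)

dual-involutive : (x : Vec Bool n) → dual (dual x) ≡ x
dual-involutive x = begin
  reverse (map not (reverse (map not x))) ≡⟨ cong reverse (map-reverse not (map not x)) ⟩
  reverse (reverse (map not (map not x))) ≡⟨ reverse-involutive _ ⟩
  map not (map not x)                     ≡⟨ map-∘ not not x ⟨
  map (not ∘ not) x                       ≡⟨ map-cong not-involutive x ⟩
  map (λ a → a) x                         ≡⟨ map-id x ⟩
  x                                       ∎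
  where open ≡-Reasoning

distance-dual : (x y : Vec Bool n) → distance (dual x) (dual y) ≡ distance x y
distance-dual []      []      = refl
distance-dual (a ∷ x) (b ∷ y) = begin
  distance (dual (a ∷ x)) (dual (b ∷ y))                     ≡⟨ cong₂ distance (dual-∷ a x) (dual-∷ b y) ⟩
  distance (dual x ∷ʳ not a) (dual y ∷ʳ not b)               ≡⟨ distance-∷ʳ (not a) (not b) (dual x) (dual y) ⟩
  distance (not a ∷ dual x) (not b ∷ dual y)                 ≡⟨ distance-∷ (not a) (not b) (dual x) (dual y) ⟩
  distance (not a ∷ []) (not b ∷ []) + distance (dual x) (dual y) ≡⟨ cong₂ _+_ (distance-not a b) (distance-dual x y) ⟩
  distance (a ∷ []) (b ∷ []) + distance x y                  ≡⟨ distance-∷ a b x y ⟨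
  distance (a ∷ x) (b ∷ y)                                   ∎
  where
  open ≡-Reasoning
  distance-not : ∀ a b → distance (not a ∷ []) (not b ∷ []) ≡ distance (a ∷ []) (b ∷ [])
  distance-not true  true  = refl
  distance-not true  false = refl
  distance-not false true  = refl
  distance-not false false = refl

depth-∷ʳ-true : ∀ t (x : Vec Bool n) → depth t (x ∷ʳ true) ≡ suc (depth t x)
depth-∷ʳ-true t []          = refl
depth-∷ʳ-true t (true  ∷ x) = depth-∷ʳ-true (suc t) x
depth-∷ʳ-true t (false ∷ x) = depth-∷ʳ-true (pred t) x

depth-∷ʳ-false : ∀ t (x : Vec Bool n) → depth t (x ∷ʳ false) ≡ pred (depth t x)
depth-∷ʳ-false t []          = refl
depth-∷ʳ-false t (true  ∷ x) = depth-∷ʳ-false (suc t) x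
depth-∷ʳ-false t (false ∷ x) = depth-∷ʳ-false (pred t) x

fill-∷ʳ-true : ∀ t (x : Vec Bool n) → fill t (x ∷ʳ true) ≡ fill t x ∷ʳ true
fill-∷ʳ-true t       []          = refl
fill-∷ʳ-true t       (true  ∷ x) = cong (true ∷_) (fill-∷ʳ-true (suc t) x)
fill-∷ʳ-true zero    (false ∷ x) = cong (true ∷_) (fill-∷ʳ-true 0 x)
fill-∷ʳ-true (suc t) (false ∷ x) = cong (false ∷_) (fill-∷ʳ-true t x)

-- No one of `1ᵗ x` is left open, so the appended zero is unmatched.
fill-∷ʳ-false-free : ∀ t (x : Vec Bool n) → depth t x ≡ 0 → fill t (x ∷ʳ false) ≡ fill t x ∷ʳ true
fill-∷ʳ-false-free zero    []          _  = refl
fill-∷ʳ-false-free t       (true  ∷ x) eq = cong (true ∷_) (fill-∷ʳ-false-free (suc t) x eq)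
fill-∷ʳ-false-free zero    (false ∷ x) eq = cong (true ∷_) (fill-∷ʳ-false-free 0 x eq)
fill-∷ʳ-false-free (suc t) (false ∷ x) eq = cong (false ∷_) (fill-∷ʳ-false-free t x eq)

fill-∷ʳ-false-matched : ∀ t (x : Vec Bool n) → 0 < depth t x → fill t (x ∷ʳ false) ≡ fill t x ∷ʳ false
fill-∷ʳ-false-matched (suc t) []          _ = refl
fill-∷ʳ-false-matched t       (true  ∷ x) p = cong (true ∷_) (fill-∷ʳ-false-matched (suc t) x p)
fill-∷ʳ-false-matched zero    (false ∷ x) p = cong (true ∷_) (fill-∷ʳ-false-matched 0 x p)
fill-∷ʳ-false-matched (suc t) (false ∷ x) p = cong (false ∷_) (fill-∷ʳ-false-matched t x p)

depth-dual : (x : Vec Bool n) → depth 0 (dual x) ≡ freeZeros x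
depth-dual []          = refl
depth-dual (true  ∷ x) =
  trans (cong (depth 0) (dual-∷ true x)) (trans (depth-∷ʳ-false 0 (dual x)) (cong pred (depth-dual x)))
depth-dual (false ∷ x) =
  trans (cong (depth 0) (dual-∷ false x)) (trans (depth-∷ʳ-true 0 (dual x)) (cong suc (depth-dual x)))

freeZeros-dual : (x : Vec Bool n) → freeZeros (dual x) ≡ depth 0 x
freeZeros-dual x = trans (sym (depth-dual (dual x))) (cong (depth 0) (dual-involutive x))

-- Filling never lowers the number of unmatched ones, so the dual has at least `depth 0 x` unmatched
-- zeros. These absorb the whole prefix, and only the unmatched ones of the dual remain.
depth-dual-fill : ∀ t (x : Vec Bool n) → depth (depth 0 x) (dual (fill t x)) ≡ t ⊓ freeZeros x
depth-dual-fill t x = begin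
  depth (depth 0 x) (dual (fill t x))
    ≡⟨ depth-formula (depth 0 x) (dual (fill t x)) ⟩
  depth 0 (dual (fill t x)) + (depth 0 x ∸ freeZeros (dual (fill t x)))
    ≡⟨ cong₂ (λ i j → i + (depth 0 x ∸ j)) (depth-dual (fill t x)) (freeZeros-dual (fill t x)) ⟩
  freeZeros (fill t x) + (depth 0 x ∸ depth 0 (fill t x))
    ≡⟨ cong (λ k → freeZeros (fill t x) + (depth 0 x ∸ k)) (depth-fill t x) ⟩
  freeZeros (fill t x) + (depth 0 x ∸ (depth 0 x + (freeZeros x ∸ t)))
    ≡⟨ cong (freeZeros (fill t x) +_) (m≤n⇒m∸n≡0 (m≤m+n (depth 0 x) _)) ⟩
  freeZeros (fill t x) + 0
    ≡⟨ +-identityʳ _ ⟩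
  freeZeros (fill t x)
    ≡⟨ freeZeros-fill t x ⟩
  t ⊓ freeZeros x
    ∎
  where open ≡-Reasoning

-- Filling the dual turns the ones created by fill t back into zeros: they are
-- unmatched, and to the left of the depth 0 x unmatched ones of x.
fill-dual-fill : ∀ t (x : Vec Bool n) → fill (depth 0 x) (dual (fill t x)) ≡ dual x
fill-dual-fill t []          = refl
fill-dual-fill t (true ∷ x)  = begin
  fill d (dual (true ∷ y))    ≡⟨ cong (fill d) (dual-∷ true y) ⟩
  fill d (dual y ∷ʳ false)    ≡⟨ last-bit ⟩
  dual x ∷ʳ false             ≡⟨ dual-∷ true x ⟨
  dual (true ∷ x)             ∎
  where
  open ≡-Reasoning
  d = depth 1 x
  y = fill (suc t) x
  last-bit : fill d (dual y ∷ʳ false) ≡ dual x ∷ʳ false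
  last-bit with freeZeros x in eq
  -- The leading one is unmatched and `y` is `x`. Now `d` exceeds the number of unmatched zeros of
  -- `dual x` by one, and the spare one matches the last zero.
  ... | zero
    rewrite freeZeros≤⇒fill≡ (suc t) x (≤-trans (≤-reflexive eq) z≤n)
          | depth-formula 1 x | eq | +-comm (depth 0 x) 1 = trans
      (fill-∷ʳ-false-matched (suc (depth 0 x)) (dual x)
        (subst (0 <_) (sym (trans (depth-formula (suc (depth 0 x)) (dual x))
          (cong₂ (λ i j → i + (suc (depth 0 x) ∸ j)) (depth-dual x) (freeZeros-dual x))))
          (≤-trans (≤-reflexive (sym (m+n∸n≡m 1 (depth 0 x)))) (m≤n+m _ (freeZeros x)))))
      (cong (_∷ʳ false) (freeZeros≤⇒fill≡ (suc (depth 0 x)) (dual x)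
        (≤-trans (≤-reflexive (freeZeros-dual x)) (n≤1+n _))))
  -- The leading one matches the leftmost unmatched zero of `x`, which `fill (suc t)` keeps; in the
  -- dual a one is therefore still open when the last zero is reached.
  ... | suc k
    rewrite depth-formula 1 x | eq | 0∸n≡0 k | +-identityʳ (depth 0 x) = trans
      (fill-∷ʳ-false-matched (depth 0 x) (dual y)
        (subst (0 <_) (sym (trans (depth-dual-fill (suc t) x) (cong (suc t ⊓_) eq))) (s≤s z≤n)))
      (cong (_∷ʳ false) (fill-dual-fill (suc t) x))
fill-dual-fill zero    (false ∷ x) = begin
  fill d (dual (true ∷ y))    ≡⟨ cong (fill d) (dual-∷ true y) ⟩
  fill d (dual y ∷ʳ false)    ≡⟨ fill-∷ʳ-false-free d (dual y) (depth-dual-fill 0 x) ⟩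
  fill d (dual y) ∷ʳ true     ≡⟨ cong (_∷ʳ true) (fill-dual-fill 0 x) ⟩
  dual x ∷ʳ true              ≡⟨ dual-∷ false x ⟨
  dual (false ∷ x)            ∎
  where
  open ≡-Reasoning
  d = depth 0 x
  y = fill 0 x
fill-dual-fill (suc t) (false ∷ x) = begin
  fill d (dual (false ∷ y))   ≡⟨ cong (fill d) (dual-∷ false y) ⟩
  fill d (dual y ∷ʳ true)     ≡⟨ fill-∷ʳ-true d (dual y) ⟩
  fill d (dual y) ∷ʳ true     ≡⟨ cong (_∷ʳ true) (fill-dual-fill t x) ⟩
  dual x ∷ʳ true              ≡⟨ dual-∷ false x ⟨
  dual (false ∷ x)            ∎
  where
  open ≡-Reasoning
  d = depth 0 x
  y = fill t x

-- Lipschitz bounds for filling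

fill-suc : ∀ t (x : Vec Bool n) → distance (fill (suc t) x) (fill t x) ≤ℕ 1
fill-suc t       []          = z≤n
fill-suc t       (true  ∷ x) = fill-suc (suc t) x
fill-suc zero    (false ∷ x) = s≤s (≤-reflexive (distance-refl (fill 0 x)))
fill-suc (suc t) (false ∷ x) = fill-suc t x

fill-pred : ∀ t (x : Vec Bool n) → distance (fill t x) (fill (pred t) x) ≤ℕ 1
fill-pred zero    x = ≤-trans (≤-reflexive (distance-refl (fill 0 x))) z≤n
fill-pred (suc t) x = fill-suc t x

edge-freeZeros-≤ : {x y : Vec Bool n} → Edge x y → freeZeros x ≤ℕ freeZeros y
edge-freeZeros-≤ (here x)        = ≤-trans pred[n]≤n (n≤1+n _)
edge-freeZeros-≤ (there true  e) = pred-mono-≤ (edge-freeZeros-≤ e)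
edge-freeZeros-≤ (there false e) = s≤s (edge-freeZeros-≤ e)

-- The edge costs at most one bit. After it the counters of open ones differ by at most two, and
-- each unit costs at most one further bit.
edge-fill : ∀ t {x y : Vec Bool n} → Edge x y → distance (fill t x) (fill t y) ≤ℕ 3
edge-fill zero    (here x)        = ≤-trans (fill-suc 0 x) (s≤s z≤n)
edge-fill (suc t) (here x)        = s≤s (≤-trans
  (distance-triangle (fill (2 + t) x) (fill (1 + t) x) (fill t x))
  (+-mono-≤ (fill-suc (suc t) x) (fill-suc t x)))
edge-fill t       (there true  e) = edge-fill (suc t) e
edge-fill zero    (there false e) = edge-fill 0 e
edge-fill (suc t) (there false e) = edge-fill t e

-- The counters stay one apart up to the edge unless an earlier zero exhausts the smaller one. That
-- zero costs one bit and makes the counters equal, leaving the 3 of `edge-fill`.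
edge-fill-+1 : ∀ t {x y : Vec Bool n} → Edge x y → distance (fill t x) (fill (1 + t) y) ≤ℕ 4
edge-fill-+1 t       (here x)        = s≤s (≤-trans (fill-suc t x) (s≤s z≤n))
edge-fill-+1 t       (there true  e) = edge-fill-+1 (suc t) e
edge-fill-+1 zero    (there false e) = s≤s (edge-fill 0 e)
edge-fill-+1 (suc t) (there false e) = edge-fill-+1 t e

-- Here the edge itself makes the counters equal. The worst case is an earlier zero met with
-- counters 0 and 2: it costs one bit and leaves them one apart, giving 1 + 4.
edge-fill-+2 : ∀ t {x y : Vec Bool n} → Edge x y → distance (fill t x) (fill (2 + t) y) ≤ℕ 5
edge-fill-+2 t       (here x)        = s≤s (≤-trans (≤-reflexive (distance-refl (fill (suc t) x))) z≤n)
edge-fill-+2 t       (there true  e) = edge-fill-+2 (suc t) e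
edge-fill-+2 zero    (there false e) = s≤s (edge-fill-+1 0 e)
edge-fill-+2 (suc t) (there false e) = edge-fill-+2 t e

-- The second alternative makes the hypothesis stable under removing a leading bit.
edge-fill-sharp : ∀ t {x y : Vec Bool n} → Edge x y →
  freeZeros y ≤ℕ suc (freeZeros x) ⊎ freeZeros x < t →
  distance (fill t x) (fill t y) ≤ℕ 2
edge-fill-sharp zero    (here x) _ = ≤-trans (fill-suc 0 x) (s≤s z≤n)
edge-fill-sharp (suc t) (here x) h = s≤s (subst (λ y → distance y (fill t x) ≤ℕ 1) same (fill-suc t x))
  where
  -- The first alternative forces the tail to have no unmatched zero. In either case `1 + t`
  -- prefixed ones match every zero of the tail, so one more changes nothing.
  few : suc (freeZeros x) ≤ℕ suc (pred (freeZeros x)) ⊎ pred (freeZeros x) < suc t → freeZeros x ≤ℕ suc t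
  few p with freeZeros x
  few _              | zero  = z≤n
  few (inj₁ (s≤s p)) | suc k = contradiction p (n≮n k)
  few (inj₂ p)       | suc k = p
  same : fill (1 + t) x ≡ fill (2 + t) x
  same = trans (freeZeros≤⇒fill≡ (1 + t) x (few h)) (sym (freeZeros≤⇒fill≡ (2 + t) x (≤-trans (few h) (n≤1+n _))))
edge-fill-sharp t {x = true ∷ x} {true ∷ y} (there true e) h = edge-fill-sharp (suc t) e (weaken h)
  where
  weaken : pred (freeZeros y) ≤ℕ suc (pred (freeZeros x)) ⊎ pred (freeZeros x) < t →
           freeZeros y ≤ℕ suc (freeZeros x) ⊎ freeZeros x < suc t
  weaken p with freeZeros x | freeZeros y
  -- Truncation in `pred` can destroy the first alternative here, and the second takes over.
  weaken _        | zero  | _     = inj₂ (s≤s z≤n)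
  weaken _        | suc _ | zero  = inj₁ z≤n
  weaken (inj₁ p) | suc _ | suc _ = inj₁ (s≤s p)
  weaken (inj₂ p) | suc _ | _     = inj₂ (s≤s p)
edge-fill-sharp zero    (there false e) (inj₁ p)       = edge-fill-sharp 0 e (inj₁ (s≤s⁻¹ p))
edge-fill-sharp (suc t) (there false e) (inj₁ p)       = edge-fill-sharp t e (inj₁ (s≤s⁻¹ p))
edge-fill-sharp (suc t) (there false e) (inj₂ (s≤s p)) = edge-fill-sharp t e (inj₂ p)

-- In the worst case of `edge-fill-+1` the cost left after the exhausting zero is now the 2 of
-- `edge-fill-sharp`.
edge-fill-+1-sharp : ∀ t {x y : Vec Bool n} → Edge x y →
  freeZeros y ≤ℕ suc (freeZeros x) ⊎ freeZeros x ≤ℕ t →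
  distance (fill t x) (fill (1 + t) y) ≤ℕ 3
edge-fill-+1-sharp t (here x) _ = s≤s (≤-trans (fill-suc t x) (s≤s z≤n))
edge-fill-+1-sharp t {x = true ∷ x} {true ∷ y} (there true e) h = edge-fill-+1-sharp (suc t) e (weaken h)
  where
  weaken : pred (freeZeros y) ≤ℕ suc (pred (freeZeros x)) ⊎ pred (freeZeros x) ≤ℕ t →
           freeZeros y ≤ℕ suc (freeZeros x) ⊎ freeZeros x ≤ℕ suc t
  weaken p with freeZeros x | freeZeros y
  weaken _        | zero  | _     = inj₂ z≤n
  weaken _        | suc _ | zero  = inj₁ z≤n
  weaken (inj₁ p) | suc _ | suc _ = inj₁ (s≤s p)
  weaken (inj₂ p) | suc _ | _     = inj₂ (s≤s p)
edge-fill-+1-sharp zero    (there false e) (inj₁ p)       = s≤s (edge-fill-sharp 0 e (inj₁ (s≤s⁻¹ p)))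
edge-fill-+1-sharp (suc t) (there false e) (inj₁ p)       = edge-fill-+1-sharp t e (inj₁ (s≤s⁻¹ p))
edge-fill-+1-sharp (suc t) (there false e) (inj₂ (s≤s p)) = edge-fill-+1-sharp t e (inj₂ p)

-- The bijection between the cube and the ball

even : ℕ → Bool
even zero          = true
even (suc zero)    = false
even (suc (suc k)) = even k

parity : Bool → ℕ
parity true  = 0
parity false = 1

-- For an odd number of unmatched zeros the larger part is turned; the extra one replaces the
-- leading `true` of the even case in making the string heavy.
toBall : Vec Bool n → Vec Bool (suc n)
toBall x = even (freeZeros x) ∷ fill ⌊ freeZeros x /2⌋ x

-- The inverse seen in the dual, where the unmatched ones of the ball point are zeros:
-- `parity b + depth 0 x` of them are to be turned. It is kept apart from the isometry `dual` so
-- that its Lipschitz bound can be checked on edges.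
unfill : Vec Bool (suc n) → Vec Bool n
unfill (b ∷ x) = fill (freeZeros x ∸ (parity b + depth 0 x)) x

fromBall : Vec Bool (suc n) → Vec Bool n
fromBall (b ∷ u) = dual (unfill (b ∷ dual u))

∸⌊/2⌋ : ∀ k → k ∸ ⌊ k /2⌋ ≡ parity (even k) + ⌊ k /2⌋
∸⌊/2⌋ zero          = refl
∸⌊/2⌋ (suc zero)    = refl
∸⌊/2⌋ (suc (suc k)) = begin
  suc k ∸ ⌊ k /2⌋                   ≡⟨ +-∸-assoc 1 (⌊n/2⌋≤n k) ⟩
  suc (k ∸ ⌊ k /2⌋)                 ≡⟨ cong suc (∸⌊/2⌋ k) ⟩
  suc (parity (even k) + ⌊ k /2⌋)   ≡⟨ +-suc (parity (even k)) ⌊ k /2⌋ ⟨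
  parity (even k) + suc ⌊ k /2⌋     ∎
  where open ≡-Reasoning

⌊parity+2*/2⌋ : ∀ b k → ⌊ parity b + (k + k) /2⌋ ≡ k
⌊parity+2*/2⌋ true  k = sym (n≡⌊n+n/2⌋ k)
⌊parity+2*/2⌋ false k = sym (n≡⌈n+n/2⌉ k)

even-parity+2* : ∀ b k → even (parity b + (k + k)) ≡ b
even-parity+2* true  zero    = refl
even-parity+2* false zero    = refl
even-parity+2* true  (suc k) rewrite +-suc k k = even-parity+2* true k
even-parity+2* false (suc k) rewrite +-suc k k = even-parity+2* false k

freeZeros-half : (x : Vec Bool n) → freeZeros (fill ⌊ freeZeros x /2⌋ x) ≡ ⌊ freeZeros x /2⌋
freeZeros-half x = trans (freeZeros-fill ⌊ freeZeros x /2⌋ x) (m≤n⇒m⊓n≡m (⌊n/2⌋≤n (freeZeros x)))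

depth-half : (x : Vec Bool n) →
  depth 0 (fill ⌊ freeZeros x /2⌋ x) ≡ depth 0 x + (parity (even (freeZeros x)) + ⌊ freeZeros x /2⌋)
depth-half x = trans (depth-fill ⌊ freeZeros x /2⌋ x) (cong (λ k → depth 0 x + k) (∸⌊/2⌋ (freeZeros x)))

fromBall-∷ : ∀ b (u : Vec Bool n) →
  fromBall (b ∷ u) ≡ dual (fill (depth 0 u ∸ (parity b + freeZeros u)) (dual u))
fromBall-∷ b u = cong₂ (λ i j → dual (fill (i ∸ (parity b + j)) (dual u))) (freeZeros-dual u) (depth-dual u)

-- The number of bits to keep evaluates to `depth 0 x`, exactly what `fill-dual-fill` needs.
fromBall-toBall : (x : Vec Bool n) → fromBall (toBall x) ≡ x
fromBall-toBall x = begin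
  fromBall (b ∷ u)
    ≡⟨ fromBall-∷ b u ⟩
  dual (fill (depth 0 u ∸ (parity b + freeZeros u)) (dual u))
    ≡⟨ cong₂ (λ i j → dual (fill (i ∸ (parity b + j)) (dual u))) (depth-half x) (freeZeros-half x) ⟩
  dual (fill (depth 0 x + (parity b + h) ∸ (parity b + h)) (dual u))
    ≡⟨ cong (λ k → dual (fill k (dual u))) (m+n∸n≡m (depth 0 x) (parity b + h)) ⟩
  dual (fill (depth 0 x) (dual u))
    ≡⟨ cong dual (fill-dual-fill h x) ⟩
  dual (dual x)
    ≡⟨ dual-involutive x ⟩
  x
    ∎
  where
  open ≡-Reasoning
  h = ⌊ freeZeros x /2⌋
  b = even (freeZeros x)
  u = fill h x

-- The hypothesis rules out truncation in `s`, so the preimage has `parity b + freeZeros u` new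
-- unmatched zeros besides the `freeZeros u` old ones. Halving the total recovers `freeZeros u`, and
-- its parity recovers `b`.
toBall-fromBall : ∀ b (u : Vec Bool n) → parity b + freeZeros u ≤ℕ depth 0 u → toBall (fromBall (b ∷ u)) ≡ b ∷ u
toBall-fromBall b u c≤d = trans (cong toBall (fromBall-∷ b u)) (cong₂ _∷_
  (trans (cong even free) (even-parity+2* b (freeZeros u)))
  (begin
    fill ⌊ freeZeros x /2⌋ x      ≡⟨ cong (λ k → fill k x) (trans (cong ⌊_/2⌋ free) (⌊parity+2*/2⌋ b (freeZeros u))) ⟩
    fill (freeZeros u) x          ≡⟨ cong (λ k → fill k x) (depth-dual u) ⟨
    fill (depth 0 (dual u)) x     ≡⟨ fill-dual-fill s (dual u) ⟩
    dual (dual u)                 ≡⟨ dual-involutive u ⟩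
    u                             ∎))
  where
  open ≡-Reasoning
  s = depth 0 u ∸ (parity b + freeZeros u)
  x = dual (fill s (dual u))
  free : freeZeros x ≡ parity b + (freeZeros u + freeZeros u)
  free = begin
    freeZeros x                                       ≡⟨ freeZeros-dual (fill s (dual u)) ⟩
    depth 0 (fill s (dual u))                         ≡⟨ depth-fill s (dual u) ⟩
    depth 0 (dual u) + (freeZeros (dual u) ∸ s)       ≡⟨ cong₂ (λ i j → i + (j ∸ s)) (depth-dual u) (freeZeros-dual u) ⟩
    freeZeros u + (depth 0 u ∸ s)                     ≡⟨ cong (λ k → freeZeros u + k) (m∸[m∸n]≡n c≤d) ⟩
    freeZeros u + (parity b + freeZeros u)            ≡⟨ +-comm (freeZeros u) _ ⟩
    parity b + freeZeros u + freeZeros u              ≡⟨ +-assoc (parity b) _ _ ⟩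
    parity b + (freeZeros u + freeZeros u)            ∎

+-diagonal-cancel-≤ : ∀ {i j} → i + i ≤ℕ j + j → i ≤ℕ j
+-diagonal-cancel-≤ p = ≮⇒≥ λ j<i → <⇒≱ (+-mono-< j<i j<i) p

+-diagonal-cancel-< : ∀ {i j} → i + i < j + j → i < j
+-diagonal-cancel-< p = ≰⇒> λ j≤i → ≤⇒≯ (+-mono-≤ j≤i j≤i) p

-- By `weight-depth`, `depth 0 u` minus `freeZeros u` is twice the weight of `u` minus 2q. Heaviness
-- makes this nonnegative for `b = true` and positive for `b = false`.
heavy⇒parity+freeZeros≤depth : ∀ {q} b (u : Vec Bool n) → q + q ≡ n →
  q < weight (b ∷ u) → parity b + freeZeros u ≤ℕ depth 0 u
heavy⇒parity+freeZeros≤depth {q = q} true u refl (s≤s q≤w) = +-cancelʳ-≤ (q + q) _ _ (begin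
  freeZeros u + (q + q)               ≤⟨ +-monoʳ-≤ (freeZeros u) (+-mono-≤ q≤w q≤w) ⟩
  freeZeros u + (weight u + weight u) ≡⟨ weight-depth u ⟩
  depth 0 u + (q + q)                 ∎)
  where open ≤-Reasoning
heavy⇒parity+freeZeros≤depth {q = q} false u refl q<w = +-cancelʳ-≤ (q + q) _ _ (begin
  suc (freeZeros u + (q + q))         ≡⟨ +-suc (freeZeros u) (q + q) ⟨
  freeZeros u + (suc q + q)           ≤⟨ +-monoʳ-≤ (freeZeros u) (+-mono-≤ q<w (<⇒≤ q<w)) ⟩
  freeZeros u + (weight u + weight u) ≡⟨ weight-depth u ⟩
  depth 0 u + (q + q)                 ∎)
  where open ≤-Reasoning

parity+freeZeros≤depth⇒heavy : ∀ {q} b (u : Vec Bool n) → q + q ≡ n →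
  parity b + freeZeros u ≤ℕ depth 0 u → q < weight (b ∷ u)
parity+freeZeros≤depth⇒heavy {q = q} true u refl p = s≤s (+-diagonal-cancel-≤ (+-cancelˡ-≤ (freeZeros u) _ _ (begin
  freeZeros u + (q + q)               ≤⟨ +-monoˡ-≤ (q + q) p ⟩
  depth 0 u + (q + q)                 ≡⟨ weight-depth u ⟨
  freeZeros u + (weight u + weight u) ∎)))
  where open ≤-Reasoning
parity+freeZeros≤depth⇒heavy {q = q} false u refl p = +-diagonal-cancel-< (+-cancelˡ-≤ (freeZeros u) _ _ (begin
  freeZeros u + suc (q + q)           ≡⟨ +-suc (freeZeros u) (q + q) ⟩
  suc (freeZeros u) + (q + q)         ≤⟨ +-monoˡ-≤ (q + q) p ⟩
  depth 0 u + (q + q)                 ≡⟨ weight-depth u ⟨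
  freeZeros u + (weight u + weight u) ∎))
  where open ≤-Reasoning

toBall-heavy : ∀ {q} (x : Vec Bool n) → q + q ≡ n → q < weight (toBall x)
toBall-heavy x 2q≡n = parity+freeZeros≤depth⇒heavy (even (freeZeros x)) (fill ⌊ freeZeros x /2⌋ x) 2q≡n
  (subst₂ (λ i j → parity (even (freeZeros x)) + i ≤ℕ j) (sym (freeZeros-half x)) (sym (depth-half x)) (m≤n+m _ (depth 0 x)))

-- Lipschitz constants of the bijection and its inverse

⌊1+n/2⌋-step : ∀ k → ⌊ suc k /2⌋ ≡ ⌊ k /2⌋ ⊎ ⌊ suc k /2⌋ ≡ suc ⌊ k /2⌋
⌊1+n/2⌋-step zero          = inj₁ refl
⌊1+n/2⌋-step (suc zero)    = inj₂ refl
⌊1+n/2⌋-step (suc (suc k)) with ⌊1+n/2⌋-step k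
... | inj₁ eq = inj₁ (cong suc eq)
... | inj₂ eq = inj₂ (cong suc eq)

within-two : ∀ {i j} → i ≤ℕ j → j ≤ℕ 2 + i → j ≡ i ⊎ j ≡ 1 + i ⊎ j ≡ 2 + i
within-two {j = 0}       z≤n _ = inj₁ refl
within-two {j = 1}       z≤n _ = inj₂ (inj₁ refl)
within-two {j = 2}       z≤n _ = inj₂ (inj₂ refl)
within-two {j = suc (suc (suc _))} z≤n (s≤s (s≤s ()))
within-two (s≤s p) (s≤s q) with within-two p q
... | inj₁ eq        = inj₁ (cong suc eq)
... | inj₂ (inj₁ eq) = inj₂ (inj₁ (cong suc eq))
... | inj₂ (inj₂ eq) = inj₂ (inj₂ (cong suc eq))

-- The weight drops by one along the edge, so by `weight-depth` the difference of `depth 0` and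
-- `freeZeros` drops by two.
edge-freeZeros-depth : {x y : Vec Bool n} → Edge x y → freeZeros y + depth 0 x ≡ 2 + (freeZeros x + depth 0 y)
edge-freeZeros-depth {n} {x} {y} e = +-cancelʳ-≡ (n + (w + w)) _ _ (begin
  (fy + dx) + (n + (w + w))             ≡⟨ solve 4 (λ fy dx n w → (fy :+ dx) :+ (n :+ (w :+ w)) := (fy :+ (w :+ w)) :+ (dx :+ n)) refl fy dx n w ⟩
  (fy + (w + w)) + (dx + n)             ≡⟨ cong₂ _+_ (weight-depth y) (sym (weight-depth x)) ⟩
  (dy + n) + (fx + (weight x + weight x)) ≡⟨ cong (λ k → (dy + n) + (fx + (k + k))) (edge-weight e) ⟩
  (dy + n) + (fx + (suc w + suc w))     ≡⟨ solve 4 (λ dy n fx w → (dy :+ n) :+ (fx :+ ((con 1 :+ w) :+ (con 1 :+ w))) := (con 2 :+ (fx :+ dy)) :+ (n :+ (w :+ w))) refl dy n fx w ⟩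
  (2 + (fx + dy)) + (n + (w + w))       ∎)
  where
  open ≡-Reasoning
  open +-*-Solver
  w = weight y
  fx = freeZeros x
  fy = freeZeros y
  dx = depth 0 x
  dy = depth 0 y

edge-freeZeros-≥ : {x y : Vec Bool n} → Edge x y → freeZeros y ≤ℕ 2 + freeZeros x
edge-freeZeros-≥ (here x) = s≤s (n≤1+pred[n] (freeZeros x))
edge-freeZeros-≥ {x = _ ∷ x} (there true e) =
  ≤-trans (pred-mono-≤ (edge-freeZeros-≥ e)) (s≤s (n≤1+pred[n] (freeZeros x)))
edge-freeZeros-≥ (there false e) = s≤s (edge-freeZeros-≥ e)

edge-depth-≤ : {x y : Vec Bool n} → Edge x y → depth 0 y ≤ℕ depth 0 x
edge-depth-≤ {x = x} {y} e = +-cancelˡ-≤ (2 + freeZeros x) _ _ (begin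
  2 + freeZeros x + depth 0 y ≡⟨ edge-freeZeros-depth e ⟨
  freeZeros y + depth 0 x     ≤⟨ +-monoˡ-≤ (depth 0 x) (edge-freeZeros-≥ e) ⟩
  2 + freeZeros x + depth 0 x ∎)
  where open ≤-Reasoning

-- The cases are the possible increases 0, 1, 2 of `freeZeros`. For 0 and 2 the leading bits agree;
-- for 1 they differ, which leaves only 3 for the filling.
edge-toBall : {x y : Vec Bool n} → Edge x y → distance (toBall x) (toBall y) ≤ℕ 4
edge-toBall {x = x} {y} e with within-two (edge-freeZeros-≤ e) (edge-freeZeros-≥ e)
... | inj₁ eq rewrite eq = begin
  distance (b ∷ fill h x) (b ∷ fill h y) ≡⟨ distance-∷-same b (fill h x) (fill h y) ⟩
  distance (fill h x) (fill h y)         ≤⟨ edge-fill h e ⟩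
  3                                      ≤⟨ n≤1+n 3 ⟩
  4                                      ∎
  where
  open ≤-Reasoning
  b = even (freeZeros x)
  h = ⌊ freeZeros x /2⌋
... | inj₂ (inj₁ eq) rewrite eq = begin
  distance (even k ∷ fill ⌊ k /2⌋ x) (even (suc k) ∷ fill ⌊ suc k /2⌋ y)
    ≡⟨ distance-∷ (even k) (even (suc k)) (fill ⌊ k /2⌋ x) (fill ⌊ suc k /2⌋ y) ⟩
  distance (even k ∷ []) (even (suc k) ∷ []) + distance (fill ⌊ k /2⌋ x) (fill ⌊ suc k /2⌋ y)
    ≤⟨ +-mono-≤ (distance-singleton (even k) (even (suc k))) fill≤3 ⟩
  4 ∎
  where
  open ≤-Reasoning
  k = freeZeros x
  fill≤3 : distance (fill ⌊ k /2⌋ x) (fill ⌊ suc k /2⌋ y) ≤ℕ 3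
  fill≤3 with ⌊1+n/2⌋-step k
  ... | inj₁ eq′ rewrite eq′ = edge-fill ⌊ k /2⌋ e
  -- The plain bound 4 would make 5 with the leading bit; an increase of exactly one allows the
  -- sharp bound.
  ... | inj₂ eq′ rewrite eq′ = edge-fill-+1-sharp ⌊ k /2⌋ e (inj₁ (≤-reflexive eq))
... | inj₂ (inj₂ eq) rewrite eq = begin
  distance (b ∷ fill h x) (b ∷ fill (suc h) y) ≡⟨ distance-∷-same b (fill h x) (fill (suc h) y) ⟩
  distance (fill h x) (fill (suc h) y)         ≤⟨ edge-fill-+1 h e ⟩
  4                                            ∎
  where
  open ≤-Reasoning
  b = even (freeZeros x)
  h = ⌊ freeZeros x /2⌋

-- Changing the first bit moves the number of kept zeros by at most one. Any other edge raises it by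
-- 0, 1 or 2, at cost 3, 4 or 5.
edge-unfill : {x y : Vec Bool (suc n)} → Edge x y → distance (unfill x) (unfill y) ≤ℕ 5
edge-unfill (here x) = ≤-trans
  (subst (λ k → distance (fill (freeZeros x ∸ depth 0 x) x) (fill k x) ≤ℕ 1)
    (pred[m∸n]≡m∸[1+n] (freeZeros x) (depth 0 x)) (fill-pred _ x))
  (s≤s z≤n)
edge-unfill {x = _ ∷ x} {_ ∷ y} (there b e) with within-two lower upper
  where
  open ≤-Reasoning
  p = parity b
  lower : freeZeros x ∸ (p + depth 0 x) ≤ℕ freeZeros y ∸ (p + depth 0 y)
  lower = ∸-mono (edge-freeZeros-≤ e) (+-monoʳ-≤ p (edge-depth-≤ e))
  upper : freeZeros y ∸ (p + depth 0 y) ≤ℕ 2 + (freeZeros x ∸ (p + depth 0 x))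
  upper = m≤n+o⇒m∸n≤o (freeZeros y) (p + depth 0 y) (+-cancelʳ-≤ (depth 0 x) _ _ (begin
    freeZeros y + depth 0 x                ≡⟨ edge-freeZeros-depth e ⟩
    2 + (freeZeros x + depth 0 y)          ≤⟨ +-monoʳ-≤ 2 (+-monoˡ-≤ (depth 0 y) (m≤n+m∸n (freeZeros x) (p + depth 0 x))) ⟩
    2 + (p + depth 0 x + s + depth 0 y)    ≡⟨ solve 4 (λ p d s d′ → con 2 :+ (p :+ d :+ s :+ d′) := p :+ d′ :+ (con 2 :+ s) :+ d)
                                                refl p (depth 0 x) s (depth 0 y) ⟩
    p + depth 0 y + (2 + s) + depth 0 x    ∎))
    where
    open +-*-Solver
    s = freeZeros x ∸ (p + depth 0 x)
... | inj₁ eq        rewrite eq = ≤-trans (edge-fill _ e) (m≤m+n 3 2)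
... | inj₂ (inj₁ eq) rewrite eq = ≤-trans (edge-fill-+1 _ e) (n≤1+n 4)
... | inj₂ (inj₂ eq) rewrite eq = edge-fill-+2 _ e

toBall-lipschitz : (x y : Vec Bool n) → distance (toBall x) (toBall y) ≤ℕ 4 * distance x y
toBall-lipschitz = edge-lipschitz⇒lipschitz 4 toBall edge-toBall

fromBall-lipschitz : (u v : Vec Bool (suc n)) → distance (fromBall u) (fromBall v) ≤ℕ 5 * distance u v
fromBall-lipschitz (a ∷ u) (b ∷ v) = begin
  distance (dual (unfill (a ∷ dual u))) (dual (unfill (b ∷ dual v))) ≡⟨ distance-dual (unfill (a ∷ dual u)) _ ⟩
  distance (unfill (a ∷ dual u)) (unfill (b ∷ dual v))               ≤⟨ edge-lipschitz⇒lipschitz 5 unfill edge-unfill (a ∷ dual u) (b ∷ dual v) ⟩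
  5 * distance (a ∷ dual u) (b ∷ dual v)                             ≡⟨ cong (5 *_) (distance-∷ a b (dual u) (dual v)) ⟩
  5 * (ab + distance (dual u) (dual v))                              ≡⟨ cong (λ k → 5 * (ab + k)) (distance-dual u v) ⟩
  5 * (ab + distance u v)                                            ≡⟨ cong (5 *_) (distance-∷ a b u v) ⟨
  5 * distance (a ∷ u) (b ∷ v)                                       ∎
  where
  open ≤-Reasoning
  ab = distance (a ∷ []) (b ∷ [])

-- Conjugated translations

conjugate : Vec Bool n → Vec Bool (suc n) → Vec Bool (suc n)
conjugate m z = toBall (fromBall z ⊕ m)

conjugate-lipschitz : (m : Vec Bool n) (z w : Vec Bool (suc n)) →
  distance (conjugate m z) (conjugate m w) ≤ℕ 20 * distance z w
conjugate-lipschitz m z w = begin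
  distance (conjugate m z) (conjugate m w)       ≤⟨ toBall-lipschitz (fromBall z ⊕ m) (fromBall w ⊕ m) ⟩
  4 * distance (fromBall z ⊕ m) (fromBall w ⊕ m) ≡⟨ cong (4 *_) (distance-⊕ (fromBall z) (fromBall w) m) ⟩
  4 * distance (fromBall z) (fromBall w)         ≤⟨ *-monoʳ-≤ 4 (fromBall-lipschitz z w) ⟩
  4 * (5 * distance z w)                         ≡⟨ *-assoc 4 5 (distance z w) ⟨
  20 * distance z w                              ∎
  where open ≤-Reasoning

n/2+n/2≡n : 2 ∣ n → n /ℕ 2 + n /ℕ 2 ≡ n
n/2+n/2≡n (divides q refl) = begin
  q * 2 /ℕ 2 + q * 2 /ℕ 2 ≡⟨ cong (λ k → k + k) (m*n/n≡m q 2) ⟩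
  q + q                   ≡⟨ cong (λ k → q + k) (+-identityʳ q) ⟨
  2 * q                   ≡⟨ *-comm 2 q ⟩
  q * 2                   ∎
  where open ≡-Reasoning

module _ {n : ℕ} (n-even : n /ℕ 2 + n /ℕ 2 ≡ n) where

  toBall-fromBall-𝓑 : (z : 𝓑 n) → toBall (fromBall (proj₁ z)) ≡ proj₁ z
  toBall-fromBall-𝓑 (b ∷ u , heavy) = toBall-fromBall b u (heavy⇒parity+freeZeros≤depth b u n-even heavy)

  conjugate-𝓑 : Vec Bool n → 𝓑 n → 𝓑 n
  conjugate-𝓑 m z = conjugate m (proj₁ z) , toBall-heavy (fromBall (proj₁ z) ⊕ m) n-even

  conjugate-𝓑-involutive : ∀ m z → conjugate-𝓑 m (conjugate-𝓑 m z) ≡ z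
  conjugate-𝓑-involutive m z = 𝓑-≡ (begin
    toBall (fromBall (toBall (fromBall (proj₁ z) ⊕ m)) ⊕ m) ≡⟨ cong (λ x → toBall (x ⊕ m)) (fromBall-toBall (fromBall (proj₁ z) ⊕ m)) ⟩
    toBall ((fromBall (proj₁ z) ⊕ m) ⊕ m)                   ≡⟨ cong toBall (⊕-cancelʳ (fromBall (proj₁ z)) m) ⟩
    toBall (fromBall (proj₁ z))                             ≡⟨ toBall-fromBall-𝓑 z ⟩
    proj₁ z                                                 ∎)
    where open ≡-Reasoning

  -- Translation by the sum of the two preimages exchanges them.
  conjugate-𝓑-swaps : ∀ x y → conjugate-𝓑 (fromBall (proj₁ y) ⊕ fromBall (proj₁ x)) x ≡ y
  conjugate-𝓑-swaps x y = 𝓑-≡ (begin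
    toBall (fx ⊕ (fy ⊕ fx)) ≡⟨ cong toBall (⊕-comm fx (fy ⊕ fx)) ⟩
    toBall ((fy ⊕ fx) ⊕ fx) ≡⟨ cong toBall (⊕-cancelʳ fy fx) ⟩
    toBall fy               ≡⟨ toBall-fromBall-𝓑 y ⟩
    proj₁ y                 ∎)
    where
    open ≡-Reasoning
    fx = fromBall (proj₁ x)
    fy = fromBall (proj₁ y)

-- Opened late because +_ clashes with sections of _+_.
open import Data.Integer.Base using (+_; +≤+) renaming (_≤_ to _≤ℤ_)
open import Data.Integer.Properties using (pos-*)

-- Comparison of fractions

1/k≤p/q : ∀ k p q .{{_ : NonZero k}} .{{_ : NonZero q}} → q ≤ℕ k * p → (+ 1 / k) ≤ (+ p / q)
-- For unnormalised fractions the order is cross multiplication.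
1/k≤p/q (suc k) p (suc q) h = toℚᵘ-cancel-≤ (begin
  _                ≃⟨ toℚᵘ-fromℚᵘ (mkℚᵘ (+ 1) k) ⟩
  mkℚᵘ (+ 1) k     ≤⟨ *≤* (subst₂ _≤ℤ_ (pos-* 1 (suc q)) (pos-* p (suc k))
                      (+≤+ (≤-trans (≤-reflexive (+-identityʳ (suc q))) (≤-trans h (≤-reflexive (*-comm (suc k) p)))))) ⟩
  mkℚᵘ (+ p) q     ≃⟨ toℚᵘ-fromℚᵘ (mkℚᵘ (+ p) q) ⟨
  _                ∎)
  where open ℚᵘₚ.≤-Reasoning

p/q≤k/1 : ∀ k p q .{{_ : NonZero q}} → p ≤ℕ k * q → (+ p / q) ≤ (+ k / 1)
p/q≤k/1 k p (suc q) h = toℚᵘ-cancel-≤ (begin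
  _                ≃⟨ toℚᵘ-fromℚᵘ (mkℚᵘ (+ p) q) ⟩
  mkℚᵘ (+ p) q     ≤⟨ *≤* (subst₂ _≤ℤ_ (pos-* p 1) (pos-* k (suc q))
                      (+≤+ (≤-trans (≤-reflexive (*-identityʳ p)) h))) ⟩
  mkℚᵘ (+ k) 0     ≃⟨ toℚᵘ-fromℚᵘ (mkℚᵘ (+ k) 0) ⟨
  _                ∎)
  where open ℚᵘₚ.≤-Reasoning

corollary1p3 : (n : ℕ) → 0 < n → 2 ∣ n → (x y : 𝓑 n) →
    Σ[ F ∈ 𝓑 n ⤖ 𝓑 n ]
    let f = Bijection.to F in
    f x ≡ y × f y ≡ x ×
    ((z w : 𝓑 n) (z≢w : z ≢ w) →
    let ratio = _/_ (+ 𝓑-distance (f z) (f w)) (𝓑-distance z w) {{𝓑-distance-nonZero z≢w}} in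
    (+ 1 / 20) ≤ ratio × ratio ≤ (+ 20 / 1))
corollary1p3 n _ 2∣n x y = ↔⇒⤖ (mk↔ₛ′ f f involutive involutive) , fx≡y , trans (cong f (sym fx≡y)) (involutive x) , bounds
  where
  c = fromBall (proj₁ y) ⊕ fromBall (proj₁ x)

  f : 𝓑 n → 𝓑 n
  f = conjugate-𝓑 (n/2+n/2≡n 2∣n) c

  involutive : ∀ z → f (f z) ≡ z
  involutive = conjugate-𝓑-involutive (n/2+n/2≡n 2∣n) c

  fx≡y : f x ≡ y
  fx≡y = conjugate-𝓑-swaps (n/2+n/2≡n 2∣n) x y

  lipschitz : ∀ z w → 𝓑-distance (f z) (f w) ≤ℕ 20 * 𝓑-distance z w
  lipschitz z w = conjugate-lipschitz c (proj₁ z) (proj₁ w)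

  bounds : (z w : 𝓑 n) (z≢w : z ≢ w) →
    let ratio = _/_ (+ 𝓑-distance (f z) (f w)) (𝓑-distance z w) {{𝓑-distance-nonZero z≢w}} in
    (+ 1 / 20) ≤ ratio × ratio ≤ (+ 20 / 1)
  bounds z w z≢w =
    1/k≤p/q 20 (𝓑-distance (f z) (f w)) (𝓑-distance z w) {{_}} {{𝓑-distance-nonZero z≢w}}
      -- The upper bound is applied to `f z` and `f w`, whose images are `z` and `w`.
      (subst₂ (λ z′ w′ → 𝓑-distance z′ w′ ≤ℕ 20 * 𝓑-distance (f z) (f w)) (involutive z) (involutive w)
        (lipschitz (f z) (f w))) ,
    p/q≤k/1 20 (𝓑-distance (f z) (f w)) (𝓑-distance z w) {{𝓑-distance-nonZero z≢w}} (lipschitz z w)
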